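{- The following three rules are sound for parametric acyclic causal teams, i.e. every parametric causal team with acyclic graph that satisfies the premises of an instance also satisfies its conclusion (here $\mathbf X,\mathbf Y$ are sets of variables, $W,X,Y$ variables, $\mathbf x,\mathbf y,w,x,x',y$ values in the respective ranges): $$(CE)\quad\frac{\mathbf X=\mathbf x\mathbin{\Box\!\!\rightarrow}W=w\qquad(\mathbf X=\mathbf x\wedge W=w)\mathbin{\Box\!\!\rightarrow}Y=y}{\mathbf X=\mathbf x\mathbin{\Box\!\!\rightarrow}Y=y}$$ $$(CI)\quad\frac{\mathbf X=\mathbf x\mathbin{\Box\!\!\rightarrow}W=w\qquad\mathbf X=\mathbf x\mathbin{\Box\!\!\rightarrow}Y=y}{(\mathbf X=\mathbf x\wedge W=w)\mathbin{\Box\!\!\rightarrow}Y=y}$$ $$(UNI)\quad\frac{\mathbf Y=\mathbf y\mathbin{\Box\!\!\rightarrow}X=x}{\mathbf Y=\mathbf y\mathbin{\Box\!\!\rightarrow}X\neq x'}\qquad(x\neq x').$$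
   Context: **Parametric causal teams.** A parametric causal team $T$ with finite set of variables $dom(T)$ is a quadruple $(T^-,G(T),\mathcal R_T,\mathcal F_T)$ where: $\mathcal R_T$ assigns to each $X\in dom(T)$ a set $Ran(X)$; $T^-$ is a set of assignments $s$ on $dom(T)$ with $s(X)\in Ran(X)$; $G(T)=(dom(T),E)$ is a directed graph, $PA_X=\{Y:(Y,X)\in E\}$; the set $\mathbf V$ of endogenous variables consists of the variables with $PA_X\ne\emptyset$; $\mathcal F_T$ assigns to each $Y\in\mathbf V$ a total function $f_Y:\prod_{X\in PA_Y}Ran(X)\to Ran(Y)$; and $s(Y)=f_Y(s(PA_Y))$ for all $s\in T^-$, $Y\in\mathbf V$. **Interventions.** For $\mathbf X\subseteq dom(T)$ let $d(\mathbf X,Z)$ be the maximal length of a directed path from some element of $\mathbf X$ to $Z$ (length $0$ allowed) in the graph obtained from $G(T)$ by deleting all arrows into $\mathbf X$, and $-1$ if there is none. $T_{\mathbf X=\mathbf x}$ is the causal team obtained from $T$ by: deleting all arrows into $\mathbf X$; setting $\mathbf X$ to $\mathbf x$ in every assignment; restricting the functional component to $\mathbf V\setminus\mathbf X$; then, for $n=1,2,\dots$ up to the maximal distance, simultaneously replacing in each assignment $s$ the values of all variables $Z$ with $d(\mathbf X,Z)=n$ by $f_Z(s(PA_Z))$. Ranges are unchanged. Interventions are defined for consistent conjunctions (the same variable always receives the same value); $\mathbf X=\mathbf x\wedge W=w$ denotes the simultaneous intervention. **Semantics.** $T\models Y=y$ iff $s(Y)=y$ for all $s\in T^-$; $T\models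 Y\neq y$ iff $s(Y)\neq y$ for all $s\in T^-$; $T\models\mathbf X=\mathbf x\mathbin{\Box\!\!\rightarrow}\chi$ iff $T_{\mathbf X=\mathbf x}\models\chi$; a counterfactual with inconsistent antecedent (containing $X_i=x_i$ and $X_i=x_i'$ with $x_i\ne x_i'$) is true by convention. -}

module Defs where

open import Data.Bool.Base using (Bool; true; false; if_then_else_; T)
open import Data.Bool.Properties using (T?)
open import Data.Fin.Base using (Fin)
open import Data.Fin.Properties using (any?; _≟_)
open import Data.Integer.Base as ℤ using (ℤ; +_; 0ℤ; -1ℤ; ∣_∣)
import Data.Integer.Properties as ℤ
open import Data.List.Base using (List; []; _∷_; allFin; filter; filterᵇ; map; upTo)
open import Data.List.Extrema ℤ.≤-totalOrder using (max)
import Data.List.Membership.DecPropositional as Membership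
open import Data.List.Membership.Propositional using (_∈_)
open import Data.List.Properties using (filter-none)
open import Data.List.Relation.Unary.All as All using (All)
open import Data.List.Relation.Unary.Any as Any using (Any)
open import Data.Nat.Base using (ℕ; zero; suc)
open import Data.Product.Base using (Σ; ∃; _×_; _,_; proj₁)
open import Relation.Binary.PropositionalEquality using (_≡_; _≢_; refl)
open import Relation.Nullary.Decidable using (Dec; yes; no; does; map′; _×-dec_)
open import Relation.Nullary.Negation using (¬_; contradiction)

------------------------------------------------------------------------
-- Directed graphs on the variables Fin n; E X Y is true iff (X , Y) is an
-- arrow.

Graph : ℕ → Set
Graph n = Fin n → Fin n → Bool

module _ {n : ℕ} where

  parents : Graph n → Fin n → List (Fin n)
  parents E Y = filterᵇ (λ X → E X Y) (allFin n)

  Endogenous : Graph n → Fin n → Set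
  Endogenous E Y = parents E Y ≢ []

  endogenous? : ∀ E Y → Dec (Endogenous E Y)
  endogenous? E Y with parents E Y
  ... | []    = no λ ne → ne refl
  ... | _ ∷ _ = yes λ ()

  -- Path E k X Z: a directed path of length k from X to Z. Vertices may
  -- repeat; in an acyclic graph they cannot.
  data Path (E : Graph n) : ℕ → Fin n → Fin n → Set where
    []  : ∀ {X} → Path E zero X X
    _∷_ : ∀ {k X Y Z} → T (E X Y) → Path E k Y Z → Path E (suc k) X Z

  path? : ∀ E k X Z → Dec (Path E k X Z)
  path? E zero    X Z = map′ (λ { refl → [] }) (λ { [] → refl }) (X ≟ Z)
  path? E (suc k) X Z =
    map′ (λ (_ , e , p) → e ∷ p) (λ { (e ∷ p) → _ , e , p })
         (any? λ Y → T? (E X Y) ×-dec path? E k Y Z)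

  Acyclic : Graph n → Set
  Acyclic E = ∀ X k → ¬ Path E (suc k) X X

  open Membership (_≟_ {n}) using (_∈?_)

  cutInto : List (Fin n) → Graph n → Graph n
  cutInto Xs E X Y = if does (Y ∈? Xs) then false else E X Y

  -- Paths in an acyclic graph on n vertices have length less than n, so
  -- the maximum is taken over all path lengths.
  distance : Graph n → List (Fin n) → Fin n → ℤ
  distance E Xs Z = max -1ℤ (map +_ (filter reachable? (upTo n)))
    where
    reachable? : ∀ k → Dec (Any (λ X → Path (cutInto Xs E) k X Z) Xs)
    reachable? k = Any.any? (λ X → path? (cutInto Xs E) k X Z) Xs

  maxDistance : Graph n → List (Fin n) → ℕ
  maxDistance E Xs = ∣ max 0ℤ (map (distance E Xs) (allFin n)) ∣

------------------------------------------------------------------------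
-- Causal teams with variables Fin n and ranges Ran. Interventions never
-- change these two components, so they are parameters.

module _ {n : ℕ} (Ran : Fin n → Set) where

  Assignment : Set
  Assignment = ∀ X → Ran X

  -- All Ran (parents E Y) is the product of the ranges of the parents of
  -- Y. Endogenous E Y is a negation, so any two of its proofs are
  -- definitionally equal and `function` cannot depend on the one supplied.
  -- The condition that assignments obey the functions is IsCausalTeam.
  record PreCausalTeam : Set₁ where
    field
      team     : Assignment → Set
      graph    : Graph n
      function : ∀ Y → Endogenous graph Y → All Ran (parents graph Y) → Ran Y

  -- A conjunction X₁ = x₁ ∧ … ∧ Xₖ = xₖ.
  Conjunction : Set
  Conjunction = List (Σ (Fin n) Ran)

module _ {n : ℕ} {Ran : Fin n → Set} where

  open PreCausalTeam
  open Membership (_≟_ {n}) using (_∈?_)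

  restrict : Assignment Ran → (Xs : List (Fin n)) → All Ran Xs
  restrict s = All.universal s

  IsCausalTeam : PreCausalTeam Ran → Set
  IsCausalTeam T = ∀ s → team T s → ∀ Y (endo : Endogenous (graph T) Y) →
    s Y ≡ function T Y endo (restrict s (parents (graph T) Y))

  variables : Conjunction Ran → List (Fin n)
  variables = map proj₁

  Consistent : Conjunction Ran → Set
  Consistent α = ∀ {X x x′} → (X , x) ∈ α → (X , x′) ∈ α → x ≡ x′

  -- If α gives a variable several values, the first is used. Satisfaction
  -- below only consults interventions with α consistent.
  set : Conjunction Ran → Assignment Ran → Assignment Ran
  set []            s Z = s Z
  set ((X , x) ∷ α) s Z with X ≟ Z
  ... | yes refl = x
  ... | no _     = set α s Z

  -- For k ≥ 1, a variable at distance k is not in α and has a parent, so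
  -- it is endogenous in the original and in the cut graph, with the same
  -- parents in both.
  update : PreCausalTeam Ran → Conjunction Ran → ℕ →
           Assignment Ran → Assignment Ran
  update T α k s Z with distance (graph T) (variables α) Z ℤ.≟ + k
                      | endogenous? (graph T) Z
  ... | yes _ | yes endo = function T Z endo (restrict s (parents (graph T) Z))
  ... | _     | _        = s Z

  updateUpTo : PreCausalTeam Ran → Conjunction Ran → ℕ →
               Assignment Ran → Assignment Ran
  updateUpTo T α zero    s = s
  updateUpTo T α (suc k) s = update T α (suc k) (updateUpTo T α k s)

  intervene : PreCausalTeam Ran → Conjunction Ran →
              Assignment Ran → Assignment Ran
  intervene T α s =
    updateUpTo T α (maxDistance (graph T) (variables α)) (set α s)

  -- Assignments are functions, so the image of the team is taken up to
  -- pointwise equality.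
  infix 30 _[_]
  _[_] : PreCausalTeam Ran → Conjunction Ran → PreCausalTeam Ran
  team     (T [ α ]) t = ∃ λ s → team T s × (∀ X → t X ≡ intervene T α s X)
  graph    (T [ α ])   = cutInto (variables α) (graph T)
  function (T [ α ]) Y endo with Y ∈? variables α
  ... | yes _ =
    contradiction (filter-none _ (All.universal (λ _ ()) (allFin n))) endo
  ... | no _  = function T Y endo

------------------------------------------------------------------------
-- Formulas and satisfaction.

infix  25 _==_ _≠_
infixr 20 _□→_

data Formula {n : ℕ} (Ran : Fin n → Set) : Set where
  _==_ : (Y : Fin n) → Ran Y → Formula Ran
  _≠_  : (Y : Fin n) → Ran Y → Formula Ran
  _□→_ : Conjunction Ran → Formula Ran → Formula Ran

infix 10 _⊨_

_⊨_ : ∀ {n} {Ran : Fin n → Set} → PreCausalTeam Ran → Formula Ran → Set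
T ⊨ Y == y = ∀ s → PreCausalTeam.team T s → s Y ≡ y
T ⊨ Y ≠ y  = ∀ s → PreCausalTeam.team T s → s Y ≢ y
T ⊨ α □→ χ = Consistent α → T [ α ] ⊨ χ

{-# OPTIONS --safe #-}
-- In an acyclic graph, an intervened assignment is the unique solution of the
-- structural equations: it has the prescribed values on the intervened
-- variables, obeys f_Z at every other endogenous variable Z, and is unchanged
-- at the remaining exogenous ones. If T_{X=x} gives W the value w, then its
-- assignments also solve the equations of the intervention X = x ∧ W = w, so by
-- uniqueness the two interventions agree on every variable.
module Submission where

open import Defs
open import Data.Bool.Base using (T)
open import Data.Nat.Base as ℕ using (ℕ; zero; suc; _≤′_; ≤′-refl; ≤′-step; s<s)
import Data.Nat.Properties as ℕ
open import Data.Fin.Base as Fin using (Fin; zero; suc)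
open import Data.Fin.Properties using (_≟_; pigeonhole)
open import Data.Integer.Base using (ℤ; +_; 0ℤ; -1ℤ; -≤+; _≤_; _<_)
import Data.Integer.Properties as ℤ
open import Data.List.Base using (List; []; _∷_; _∷ʳ_; allFin; filter; map; upTo)
open import Data.List.Extrema ℤ.≤-totalOrder using (max; argmax-sel; ⊥≤max; xs≤max)
import Data.List.Membership.DecPropositional as DecMembership
open import Data.List.Membership.Propositional using (_∈_; _∉_; find; lose)
open import Data.List.Membership.Propositional.Properties
  using (∈-allFin; ∈-filter⁺; ∈-filter⁻; ∈-map⁺; ∈-map⁻; ∈-upTo⁺; ∈-++⁻; ∈-++⁺ˡ)
open import Data.List.Relation.Binary.Subset.Propositional using (_⊆_)
open import Data.List.Relation.Binary.Subset.Propositional.Properties using (map⁺)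
open import Data.List.Relation.Unary.All as All using (_∷_)
open import Data.List.Relation.Unary.Any as Any using (Any; any?; here; there)
open import Data.Product.Base using (∃; _×_; _,_; proj₁; proj₂)
open import Data.Sum.Base using (_⊎_; inj₁; inj₂)
open import Function.Base using (_∘_; id)
open import Relation.Binary.PropositionalEquality
  using (_≡_; _≢_; refl; sym; trans; cong; cong₂; subst; module ≡-Reasoning)
open import Relation.Nullary.Decidable using (Dec; yes; no)
open import Relation.Nullary.Negation using (¬_; contradiction)

-- Serves to read a distance as either the default -1 or the length of an actual path.
max-filter-cases : ∀ {P : ℕ → Set} (P? : ∀ k → Dec (P k)) ks →
  let m = max -1ℤ (map +_ (filter P? ks)) in m ≡ -1ℤ ⊎ ∃ λ k → m ≡ + k × P k
max-filter-cases P? ks with argmax-sel id -1ℤ (map +_ (filter P? ks))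
... | inj₁ m≡-1 = inj₁ m≡-1
... | inj₂ m∈   =
  let k , k∈ , m≡k = ∈-map⁻ +_ m∈ in inj₂ (k , m≡k , proj₂ (∈-filter⁻ P? {xs = ks} k∈))

-- Paths in acyclic graphs

module _ {n : ℕ} where

  open DecMembership (_≟_ {n}) using (_∈?_)

  _∷ʳᵖ_ : ∀ {E : Graph n} {k X Y Z} → Path E k X Y → T (E Y Z) → Path E (suc k) X Z
  []      ∷ʳᵖ e′ = e′ ∷ []
  (e ∷ p) ∷ʳᵖ e′ = e ∷ (p ∷ʳᵖ e′)

  lastArrow : ∀ {E : Graph n} {k X Z} → Path E (suc k) X Z → ∃ λ Y → T (E Y Z)
  lastArrow (e ∷ [])         = _ , e
  lastArrow (_ ∷ p@(_ ∷ _)) = lastArrow p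

  mapPath : ∀ {E E′ : Graph n} → (∀ {X Y} → T (E X Y) → T (E′ X Y)) →
            ∀ {k X Z} → Path E k X Z → Path E′ k X Z
  mapPath f []      = []
  mapPath f (e ∷ p) = f e ∷ mapPath f p

  vertex : ∀ {E : Graph n} {k X Z} → Path E k X Z → Fin (suc k) → Fin n
  vertex {X = X} _       zero    = X
  vertex         (_ ∷ p) (suc i) = vertex p i

  prefix : ∀ {E : Graph n} {k X Z} (p : Path E k X Z) i →
           Path E (Fin.toℕ i) X (vertex p i)
  prefix _       zero    = []
  prefix (e ∷ p) (suc i) = e ∷ prefix p i

  -- The length is a successor so that a segment with coinciding endpoints is a cycle in the sense
  -- of `Acyclic`.
  segment : ∀ {E : Graph n} {k X Z} (p : Path E k X Z) {i j} → i Fin.< j →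
            ∃ λ m → Path E (suc m) (vertex p i) (vertex p j)
  segment (e ∷ p) {zero}  {suc j} _         = _ , e ∷ prefix p j
  segment (_ ∷ p) {suc _} {suc _} (s<s i<j) = segment p i<j

  -- A path of length at least `n` visits more than `n` vertices, so some vertex repeats, and the
  -- segment between two of its visits is a cycle.
  acyclic⇒length<n : ∀ {E : Graph n} → Acyclic E →
                     ∀ {k X Z} → Path E k X Z → k ℕ.< n
  acyclic⇒length<n {E} acyclic {k} p = ℕ.≰⇒> λ n≤k →
    let i , j , i<j , vᵢ≡vⱼ = pigeonhole (ℕ.s≤s n≤k) (vertex p)
        m , q              = segment p i<j
    in acyclic _ m (subst (Path E (suc m) (vertex p i)) (sym vᵢ≡vⱼ) q)

  -- Induction on the length of the longest path ending in a vertex.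
  acyclic-induction : ∀ {E : Graph n} → Acyclic E → (P : Fin n → Set) →
                      (∀ Z → (∀ Y → T (E Y Z) → P Y) → P Z) → ∀ Z → P Z
  acyclic-induction {E} acyclic P step Z₀ =
    -- No path has length `n`, and each step back along an arrow lowers the excluded length by one.
    -- It never reaches zero, because the empty path always exists.
    go n Z₀ λ _ p → ℕ.<-irrefl refl (acyclic⇒length<n acyclic p)
    where
    go : ∀ k Z → (∀ X → ¬ Path E k X Z) → P Z
    go zero    Z none = contradiction [] (none Z)
    go (suc k) Z none = step Z λ Y e → go k Y λ X p → none X (p ∷ʳᵖ e)

  cutInto⁺ : ∀ (E : Graph n) Xs {Y Z} → Z ∉ Xs → T (E Y Z) → T (cutInto Xs E Y Z)
  cutInto⁺ E Xs {Z = Z} Z∉ e with Z ∈? Xs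
  ... | yes Z∈ = contradiction Z∈ Z∉
  ... | no _   = e

  cutInto⁻ : ∀ (E : Graph n) Xs {Y Z} → T (cutInto Xs E Y Z) → Z ∉ Xs × T (E Y Z)
  cutInto⁻ E Xs {Z = Z} e with Z ∈? Xs
  ... | no Z∉ = Z∉ , e

  ∈-parents⁻ : ∀ (E : Graph n) {Y Z} → Y ∈ parents E Z → T (E Y Z)
  ∈-parents⁻ _ = proj₂ ∘ ∈-filter⁻ _ {xs = allFin n}

  -- Distances from the intervened variables

  Reaches : Graph n → List (Fin n) → ℕ → Fin n → Set
  Reaches E Xs k Z = Any (λ X → Path (cutInto Xs E) k X Z) Xs

  module _ (E : Graph n) (Xs : List (Fin n)) where

    distance-cases : ∀ Z → distance E Xs Z ≡ -1ℤ ⊎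
                           ∃ λ k → distance E Xs Z ≡ + k × Reaches E Xs k Z
    distance-cases Z =
      max-filter-cases (λ k → any? (λ X → path? (cutInto Xs E) k X Z) Xs) (upTo n)

    -- `distance` tests only lengths below `n`. The path also exists before the cut, so acyclicity
    -- keeps its length in that range.
    ≤distance : Acyclic E → ∀ {k Z} → Reaches E Xs k Z → + k ≤ distance E Xs Z
    ≤distance acyclic r =
      let _ , _ , p = find r
          k<n       = acyclic⇒length<n acyclic (mapPath (proj₂ ∘ cutInto⁻ E Xs) p)
      in All.lookup (xs≤max -1ℤ _) (∈-map⁺ +_ (∈-filter⁺ _ (∈-upTo⁺ k<n) r))

    -- The cut removes every arrow into `Xs`, so only an empty path can end there.
    distance-∈ : ∀ {Z} → Z ∈ Xs → distance E Xs Z ≤ 0ℤ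
    distance-∈ {Z} Z∈ with distance-cases Z
    ... | inj₁ d≡-1               = subst (_≤ 0ℤ) (sym d≡-1) -≤+
    ... | inj₂ (zero  , d≡0 , _) = ℤ.≤-reflexive d≡0
    ... | inj₂ (suc _ , _   , r) =
      let _ , _ , p = find r in
      contradiction Z∈ (proj₁ (cutInto⁻ E Xs (proj₂ (lastArrow p))))

    distance≡0⇒∈ : ∀ {Z} → distance E Xs Z ≡ 0ℤ → Z ∈ Xs
    distance≡0⇒∈ {Z} d≡0 with distance-cases Z
    ... | inj₁ d≡-1 = contradiction (trans (sym d≡-1) d≡0) λ ()
    ... | inj₂ (suc _ , d≡1+k , _) = contradiction (trans (sym d≡1+k) d≡0) λ ()
    ... | inj₂ (zero  , _ , r) with find r
    ...   | _ , Z∈ , [] = Z∈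

    reaches-child : ∀ {k Y Z} → Z ∉ Xs → T (E Y Z) →
                    Reaches E Xs k Y → Reaches E Xs (suc k) Z
    reaches-child Z∉ e = Any.map (_∷ʳᵖ cutInto⁺ E Xs Z∉ e)

    -- A longest path to `Y` extends by the arrow to `Z`, which survives the cut because `Z ∉ Xs`.
    -- An unreached `Y` is kept apart: `Z` may then be unreached too, with both distances -1.
    distance-parent : Acyclic E → ∀ {Y Z} → Z ∉ Xs → T (E Y Z) →
                      distance E Xs Y ≡ -1ℤ ⊎ distance E Xs Y < distance E Xs Z
    distance-parent acyclic {Y} Z∉ e with distance-cases Y
    ... | inj₁ d≡-1          = inj₁ d≡-1
    ... | inj₂ (k , d≡k , r) = inj₂ (subst (_< _) (sym d≡k)
      (ℤ.suc[i]≤j⇒i<j (≤distance acyclic (reaches-child Z∉ e r))))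

    distance-unreached-parent : Acyclic E → ∀ {Y Z} → Z ∉ Xs → T (E Y Z) →
                                distance E Xs Z ≡ -1ℤ → distance E Xs Y ≡ -1ℤ
    distance-unreached-parent acyclic {Y} Z∉ e d≡-1 with distance-cases Y
    ... | inj₁ d′≡-1       = d′≡-1
    ... | inj₂ (k , _ , r) = contradiction
      (subst (+ suc k ≤_) d≡-1 (≤distance acyclic (reaches-child Z∉ e r))) λ ()

    distance≡-1⇒∉ : Acyclic E → ∀ {Z} → distance E Xs Z ≡ -1ℤ → Z ∉ Xs
    distance≡-1⇒∉ acyclic d≡-1 Z∈ =
      contradiction (subst (0ℤ ≤_) d≡-1 (≤distance acyclic (lose Z∈ []))) λ ()

    -- For positive `k`, this places the round that recomputes `Z` among those that `intervene`
    -- performs.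
    ≤maxDistance : ∀ {k Z} → distance E Xs Z ≡ + k → k ℕ.≤ maxDistance E Xs
    ≤maxDistance {k} {Z} d≡k = ℤ.drop‿+≤+ (begin
      + k                  ≡⟨ d≡k ⟨
      distance E Xs Z      ≤⟨ All.lookup (xs≤max 0ℤ ds) (∈-map⁺ (distance E Xs) (∈-allFin Z)) ⟩
      max 0ℤ ds            ≡⟨ ℤ.0≤i⇒+∣i∣≡i (⊥≤max 0ℤ ds) ⟨
      + maxDistance E Xs   ∎)
      where
      open ℤ.≤-Reasoning
      ds = map (distance E Xs) (allFin n)

-- Values after an intervention

module _ {n : ℕ} {Ran : Fin n → Set} where

  open DecMembership (_≟_ {n}) using (_∈?_)

  restrict-cong : ∀ {s t : Assignment Ran} Xs → (∀ X → X ∈ Xs → s X ≡ t X) →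
                  restrict s Xs ≡ restrict t Xs
  restrict-cong []       eq = refl
  restrict-cong (X ∷ Xs) eq =
    cong₂ _∷_ (eq X (here refl)) (restrict-cong Xs λ Y → eq Y ∘ there)

  -- `set` takes the first value listed for a variable; consistency makes every other listed value
  -- equal to it.
  set-∈ : ∀ (α : Conjunction Ran) s → Consistent α →
          ∀ {Z z} → (Z , z) ∈ α → set α s Z ≡ z
  set-∈ ((X , x) ∷ α) s con {Z} Z∈ with X ≟ Z | Z∈
  ... | yes refl | _         = con (here refl) Z∈
  ... | no X≢Z   | here refl = contradiction refl X≢Z
  ... | no _     | there Z∈α = set-∈ α s (λ p q → con (there p) (there q)) Z∈α

  set-∉ : ∀ (α : Conjunction Ran) s {Z} → Z ∉ variables α → set α s Z ≡ s Z
  set-∉ []            s Z∉ = refl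
  set-∉ ((X , x) ∷ α) s {Z} Z∉ with X ≟ Z
  ... | yes refl = contradiction (here refl) Z∉
  ... | no _     = set-∉ α s (Z∉ ∘ there)

  module _ (T : PreCausalTeam Ran) where

    open PreCausalTeam T using (graph; function)

    apply : Assignment Ran → ∀ Z → Endogenous graph Z → Ran Z
    apply s Z endo = function Z endo (restrict s (parents graph Z))

    apply-cong : ∀ {s t} Z endo → (∀ Y → Y ∈ parents graph Z → s Y ≡ t Y) →
                 apply s Z endo ≡ apply t Z endo
    apply-cong Z endo eq = cong (function Z endo) (restrict-cong _ eq)

    module _ (α : Conjunction Ran) where

      vars : List (Fin n)
      vars = variables α

      dist : Fin n → ℤ
      dist = distance graph vars

      maxDist : ℕ
      maxDist = maxDistance graph vars

      update-idle : ∀ {k Z} s → dist Z ≢ + k → update T α k s Z ≡ s Z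
      update-idle {k} {Z} s d≢k with dist Z ℤ.≟ + k | endogenous? graph Z
      ... | yes d≡k | _     = contradiction d≡k d≢k
      ... | no _    | yes _ = refl
      ... | no _    | no _  = refl

      update-exogenous : ∀ {k Z} s → ¬ Endogenous graph Z → update T α k s Z ≡ s Z
      update-exogenous {k} {Z} s exo with dist Z ℤ.≟ + k | endogenous? graph Z
      ... | yes _ | yes endo = contradiction endo exo
      ... | yes _ | no _     = refl
      ... | no _  | yes _    = refl
      ... | no _  | no _     = refl

      update-active : ∀ {k Z} s endo → dist Z ≡ + k → update T α k s Z ≡ apply s Z endo
      update-active {k} {Z} s endo d≡k with dist Z ℤ.≟ + k | endogenous? graph Z
      ... | yes _  | yes _  = refl
      ... | yes _  | no exo = contradiction endo exo
      ... | no d≢k | _      = contradiction d≡k d≢k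

      -- Only round `dist Z` can change the value at `Z`, so the rounds after `j` leave it alone.
      -- The form `≤′` lets the induction peel off the last round.
      updateUpTo-stable : ∀ {j k Z} s → dist Z ≤ + j → j ≤′ k →
                          updateUpTo T α k s Z ≡ updateUpTo T α j s Z
      updateUpTo-stable s d≤j ≤′-refl       = refl
      updateUpTo-stable {j} {suc k} s d≤j (≤′-step j≤k) = trans
        (update-idle _ λ d≡1+k → ℕ.<⇒≱ (ℕ.s≤s (ℕ.≤′⇒≤ j≤k))
          (ℤ.drop‿+≤+ (subst (_≤ + j) d≡1+k d≤j)))
        (updateUpTo-stable s d≤j j≤k)

      updateUpTo-exogenous : ∀ k {Z} s → ¬ Endogenous graph Z →
                             updateUpTo T α k s Z ≡ s Z
      updateUpTo-exogenous zero    s exo = refl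
      updateUpTo-exogenous (suc k) s exo =
        trans (update-exogenous {suc k} _ exo) (updateUpTo-exogenous k s exo)

      -- Rounds are numbered from 1, so variables at distance 0 or -1 are never recomputed.
      intervene-dist≤0 : ∀ {Z} s → dist Z ≤ 0ℤ → intervene T α s Z ≡ set α s Z
      intervene-dist≤0 s d≤0 = updateUpTo-stable {k = maxDist} (set α s) d≤0 (ℕ.≤⇒≤′ ℕ.z≤n)

      intervene-∈ : Consistent α → ∀ {Z z} s → (Z , z) ∈ α → intervene T α s Z ≡ z
      intervene-∈ con s Z∈ =
        trans (intervene-dist≤0 s (distance-∈ graph vars (∈-map⁺ proj₁ Z∈)))
              (set-∈ α s con Z∈)

      intervene-exogenous : ∀ {Z} s → Z ∉ vars → ¬ Endogenous graph Z →
                            intervene T α s Z ≡ s Z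
      intervene-exogenous s Z∉ exo =
        trans (updateUpTo-exogenous maxDist _ exo) (set-∉ α s Z∉)

      intervene-unreached : ∀ {Z} s → dist Z ≡ -1ℤ → Z ∉ vars →
                            intervene T α s Z ≡ s Z
      intervene-unreached s d≡-1 Z∉ =
        trans (intervene-dist≤0 s (subst (_≤ 0ℤ) (sym d≡-1) -≤+)) (set-∉ α s Z∉)

      module _ (causal : IsCausalTeam T) (acyclic : Acyclic graph) where

        -- The parents of Z are strictly closer to the intervened variables (or
        -- unreached), so they already have their final values when Z is updated.
        intervene-endogenous : ∀ {Z s} → PreCausalTeam.team T s → Z ∉ vars →
          ∀ endo → intervene T α s Z ≡ apply (intervene T α s) Z endo
        intervene-endogenous {Z} {s} s∈T Z∉ endo
          with distance-cases graph vars Z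
        -- No path reaches `Z`, hence none reaches its parents: all keep their values from `s`, and
        -- the equation is the one `s` obeys as a team member.
        ... | inj₁ d≡-1 = begin
          intervene T α s Z              ≡⟨ intervene-unreached s d≡-1 Z∉ ⟩
          s Z                            ≡⟨ causal s s∈T Z endo ⟩
          apply s Z endo                 ≡⟨ apply-cong Z endo eq ⟨
          apply (intervene T α s) Z endo ∎
          where
          open ≡-Reasoning
          eq : ∀ Y → Y ∈ parents graph Z → intervene T α s Y ≡ s Y
          eq Y Y∈ = intervene-unreached s d′≡-1 (distance≡-1⇒∉ graph vars acyclic d′≡-1)
            where
            d′≡-1 : dist Y ≡ -1ℤ
            d′≡-1 =
              distance-unreached-parent graph vars acyclic Z∉ (∈-parents⁻ graph Y∈) d≡-1
        ... | inj₂ (zero  , d≡0 , _) = contradiction (distance≡0⇒∈ graph vars d≡0) Z∉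
        -- Round `suc k` fixes `Z` for good; `sₖ` is the assignment just before it.
        ... | inj₂ (suc k , d≡1+k , _) = begin
          intervene T α s Z              ≡⟨ updateUpTo-stable {k = maxDist} _
                                              (ℤ.≤-reflexive d≡1+k) (ℕ.≤⇒≤′ 1+k≤m) ⟩
          update T α (suc k) sₖ Z        ≡⟨ update-active {suc k} sₖ endo d≡1+k ⟩
          apply sₖ Z endo                ≡⟨ apply-cong Z endo eq ⟨
          apply (intervene T α s) Z endo ∎
          where
          open ≡-Reasoning
          sₖ : Assignment Ran
          sₖ = updateUpTo T α k (set α s)
          1+k≤m : suc k ℕ.≤ maxDist
          1+k≤m = ≤maxDistance graph vars d≡1+k
          d≤k : ∀ {Y} → Y ∈ parents graph Z → dist Y ≤ + k
          d≤k {Y} Y∈ with distance-parent graph vars acyclic Z∉ (∈-parents⁻ graph Y∈)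
          ... | inj₁ d≡-1 = subst (_≤ + k) (sym d≡-1) -≤+
          ... | inj₂ d<d  = ℤ.i<j⇒i≤pred[j] (subst (dist Y <_) d≡1+k d<d)
          eq : ∀ Y → Y ∈ parents graph Z → intervene T α s Y ≡ sₖ Y
          eq Y Y∈ = updateUpTo-stable _ (d≤k Y∈) (ℕ.≤⇒≤′ (ℕ.<⇒≤ 1+k≤m))

    -- Comparing two interventions

    module _ (causal : IsCausalTeam T) (acyclic : Acyclic graph) where

      -- Uniqueness of solutions, by induction along the arrows. On the variables of `α′` both sides
      -- have the prescribed value, on the left by `agrees`. Any other variable also lies outside
      -- `α`, so both sides keep the value from `s` if it is exogenous, and otherwise apply the same
      -- function to parents that agree by induction.
      intervene-⊆ : ∀ {α α′ s} → PreCausalTeam.team T s → α ⊆ α′ → Consistent α′ →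
        (∀ {Z z} → (Z , z) ∈ α′ → intervene T α s Z ≡ z) →
        ∀ Z → intervene T α s Z ≡ intervene T α′ s Z
      intervene-⊆ {α} {α′} {s} s∈T α⊆α′ con′ agrees = acyclic-induction acyclic _ step
        where
        open ≡-Reasoning
        step : ∀ Z → (∀ Y → _ → intervene T α s Y ≡ intervene T α′ s Y) →
               intervene T α s Z ≡ intervene T α′ s Z
        step Z ih with Z ∈? variables α′
        ... | yes Z∈ with (_ , z) , Zz∈ , refl ← ∈-map⁻ proj₁ Z∈ =
          trans (agrees Zz∈) (sym (intervene-∈ α′ con′ s Zz∈))
        ... | no Z∉′ with endogenous? graph Z
        ...   | no exo = trans (intervene-exogenous α s (Z∉′ ∘ map⁺ proj₁ α⊆α′) exo)
                               (sym (intervene-exogenous α′ s Z∉′ exo))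
        ...   | yes endo = begin
          intervene T α s Z               ≡⟨ intervene-endogenous α causal acyclic s∈T
                                               (Z∉′ ∘ map⁺ proj₁ α⊆α′) endo ⟩
          apply (intervene T α s) Z endo  ≡⟨ apply-cong Z endo (λ Y → ih Y ∘ ∈-parents⁻ graph) ⟩
          apply (intervene T α′ s) Z endo ≡⟨ intervene-endogenous α′ causal acyclic s∈T Z∉′ endo ⟨
          intervene T α′ s Z              ∎

      -- Consistency of the longer conjunction comes for free: all its conjuncts are values of the
      -- single assignment `intervene T α s`.
      intervene-∷ʳ : ∀ {α W w s} → PreCausalTeam.team T s → Consistent α →
        intervene T α s W ≡ w →
        Consistent (α ∷ʳ (W , w)) ×
        (∀ Z → intervene T α s Z ≡ intervene T (α ∷ʳ (W , w)) s Z)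
      intervene-∷ʳ {α} {W} {w} {s} s∈T con W≡w = con′ , intervene-⊆ s∈T ∈-++⁺ˡ con′ agrees
        where
        agrees : ∀ {Z z} → (Z , z) ∈ α ∷ʳ (W , w) → intervene T α s Z ≡ z
        agrees Z∈ with ∈-++⁻ α Z∈
        ... | inj₁ Z∈α         = intervene-∈ α con s Z∈α
        ... | inj₂ (here refl) = W≡w
        con′ : Consistent (α ∷ʳ (W , w))
        con′ p q = trans (sym (agrees p)) (agrees q)

-- Soundness of the three rules

theorem4p10 : (n : ℕ) (Ran : Fin n → Set) (T : PreCausalTeam Ran) →
    IsCausalTeam T → Acyclic (PreCausalTeam.graph T) →
    ((α : Conjunction Ran) (W : Fin n) (w : Ran W) (Y : Fin n) (y : Ran Y) →
    T ⊨ α □→ W == w →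
    T ⊨ (α ∷ʳ (W , w)) □→ Y == y →
    T ⊨ α □→ Y == y)
    ×
    ((α : Conjunction Ran) (W : Fin n) (w : Ran W) (Y : Fin n) (y : Ran Y) →
    T ⊨ α □→ W == w →
    T ⊨ α □→ Y == y →
    T ⊨ (α ∷ʳ (W , w)) □→ Y == y)
    ×
    ((β : Conjunction Ran) (X : Fin n) (x x′ : Ran X) → x ≢ x′ →
    T ⊨ β □→ X == x →
    T ⊨ β □→ X ≠ x′)
theorem4p10 n Ran T causal acyclic = ce , ci , uni
  where
  ce : ∀ α W w Y y → T ⊨ α □→ W == w → T ⊨ (α ∷ʳ (W , w)) □→ Y == y → T ⊨ α □→ Y == y
  ce α W w Y y W==w Y==y con t (s , s∈T , t≗) =
    -- `W==w` is applied to the intervened `s` itself, which belongs to `T [ α ]` by reflexivity.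
    -- The member `s` behind `t` thus supplies the consistency that the second premise demands.
    let con′ , eq = intervene-∷ʳ T causal acyclic s∈T con (W==w con _ (s , s∈T , λ _ → refl))
    in Y==y con′ t (s , s∈T , λ X → trans (t≗ X) (eq X))

  ci : ∀ α W w Y y → T ⊨ α □→ W == w → T ⊨ α □→ Y == y → T ⊨ (α ∷ʳ (W , w)) □→ Y == y
  ci α W w Y y W==w Y==y con′ t (s , s∈T , t≗) =
    -- Both premises ask for consistency of `α`, which is inherited from the longer conjunction.
    let con : Consistent α
        con p q = con′ (∈-++⁺ˡ p) (∈-++⁺ˡ q)
        _ , eq  = intervene-∷ʳ T causal acyclic s∈T con (W==w con _ (s , s∈T , λ _ → refl))
    in Y==y con t (s , s∈T , λ X → trans (t≗ X) (sym (eq X)))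

  uni : ∀ β X x x′ → x ≢ x′ → T ⊨ β □→ X == x → T ⊨ β □→ X ≠ x′
  uni β X x x′ x≢x′ X==x con t t∈ tX≡x′ = x≢x′ (trans (sym (X==x con t t∈)) tX≡x′)
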